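{- For any integer $n\geq 1$ we have \[ |\mathsf{BP}_n| = \sum_{i=1}^{p(n)} \prod_{j=1}^{d(i)} \binom{n-\sum_{k=1}^{j-1} k\cdot m(i,k)}{j\cdot m(i,j)} \cdot \frac{(j\cdot m(i,j))!}{m(i,j)!}. \]
   Context: Notation: $\llbracket n\rrbracket=\{0,\dots,n-1\}$. A partitioned order of $\llbracket n\rrbracket$ is an (unordered) set $\{S_k\}_{k\in\llbracket s\rrbracket}$ of $s$ non-empty finite sequences, each consisting of pairwise distinct elements of $\llbracket n\rrbracket$, the sequences being pairwise disjoint (as sets of entries) with union $\llbracket n\rrbracket$; so every element of $\llbracket n\rrbracket$ occurs at exactly one position of exactly one sequence. $\mathsf{BP}_n$ is the set of all partitioned orders of $\llbracket n\rrbracket$ (called block-parallel update modes of size $n$). Integer partitions: $p(n)$ is the number of integer partitions of $n$ (multisets of positive integers summing to $n$), listed in some fixed order as partitions number $1,\dots,p(n)$; $d(i)$ is the maximal part size of the $i$-th partition, and $m(i,j)$ is the multiplicity of the part of size $j$ in the $i$-th partition (possibly $0$). The product over $j$ ranges over the whole expression (binomial coefficient times ratio of factorials). -}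

module Defs where

open import Data.Fin using (Fin; zero; suc)
open import Data.List using (List; []; _∷_; _++_; map; length; filter; applyUpTo; tabulate; lookup; deduplicate)
open import Data.List.Extrema.Nat using (max)
open import Data.List.Membership.Propositional using (_∈_)
open import Data.List.Membership.Propositional.Properties using (∈-lookup)
open import Data.List.Properties using (≡-dec)
open import Data.List.Relation.Binary.BagAndSetEquality using ([_]-Equality; set)
open import Data.List.Relation.Binary.Disjoint.Propositional using (Disjoint)
open import Data.List.Relation.Binary.Permutation.Propositional using (_↭_; ↭-setoid; ↭-reflexive; ↭-sym; ↭-trans; ↭⇒↭ₛ)
open import Data.List.Relation.Binary.Pointwise using (Pointwise-≡⇒≡)
open import Data.List.Relation.Unary.All as All using (All; []; _∷_)
open import Data.List.Relation.Unary.AllPairs using (AllPairs; []; _∷_)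
open import Data.List.Relation.Unary.Any as Any using (Any; here; there)
open import Data.List.Relation.Unary.Any.Properties using (++⁺ˡ; ++⁺ʳ; map⁺; lookup-index)
open import Data.List.Relation.Unary.Enumerates.Setoid using (IsEnumeration)
open import Data.List.Relation.Unary.Enumerates.Setoid.Properties using (deduplicate⁺)
open import Data.List.Relation.Unary.Sorted.TotalOrder.Properties using (↗↭↗⇒≋)
open import Data.List.Relation.Unary.Unique.Propositional using (Unique)
import Data.List.Relation.Unary.Unique.DecSetoid.Properties as UniqueDec
import Data.List.Relation.Unary.Unique.Setoid as UniqueSetoid
open import Data.List.Sort using (sort; sort-↭; sort-↗)
open import Data.Nat using (ℕ; zero; suc; _>_; s≤s; z≤n; _≟_)
open import Data.Nat.ListAction using (sum; product)
open import Data.Nat.Properties using (suc-injective; ≤-decTotalOrder; ≤-totalOrder)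
open import Data.Product using (∃; _,_)
open import Function using (_∘_; Inverse)
open import Level using (0ℓ)
open import Relation.Binary using (Setoid; DecSetoid; Decidable)
import Relation.Binary.Construct.On as On
open import Relation.Binary.PropositionalEquality as ≡ using (_≡_; _≢_; refl; cong)
open import Relation.Nullary using (yes; no; contradiction)

infix 4 _HasCardinality_

_HasCardinality_ : Setoid 0ℓ 0ℓ → ℕ → Set
S HasCardinality c = Inverse S (≡.setoid (Fin c))

record PartitionedOrder (n : ℕ) : Set where
  field
    sequences : List (List (Fin n))
    non-empty : All (_≢ []) sequences
    distinct  : All Unique sequences
    disjoint  : AllPairs Disjoint sequences
    covering  : ∀ x → Any (x ∈_) sequences

-- A partitioned order is an unordered set of sequences, so two of them are
-- equal when they have the same sequences as members.
BP : ℕ → Setoid 0ℓ 0ℓ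
BP n = On.setoid ([ set ]-Equality (List (Fin n))) (PartitionedOrder.sequences {n})

record Partition (n : ℕ) : Set where
  constructor mkPartition
  field
    parts    : List ℕ
    positive : All (_> 0) parts
    sum≡n    : sum parts ≡ n

open Partition

-- A partition is a multiset of parts: lists up to permutation.
Partitions : ℕ → Setoid 0ℓ 0ℓ
Partitions n = On.setoid (↭-setoid {A = ℕ}) (parts {n})

Listing : ℕ → ℕ → Set
Listing n p = Inverse (≡.setoid (Fin p)) (Partitions n)

maxPart : ∀ {n} → Partition n → ℕ
maxPart π = max 0 (parts π)

multiplicity : ∀ {n} → Partition n → ℕ → ℕ
multiplicity π j = length (filter (_≟ j) (parts π))

-- f 1 + ⋯ + f m
∑₁ : ℕ → (ℕ → ℕ) → ℕ
∑₁ m f = sum (applyUpTo (f ∘ suc) m)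

-- f 1 * ⋯ * f m
∏₁ : ℕ → (ℕ → ℕ) → ℕ
∏₁ m f = product (applyUpTo (f ∘ suc) m)

∑Fin : (p : ℕ) → (Fin p → ℕ) → ℕ
∑Fin p f = sum (tabulate f)

-- Every n has a listing of its partitions: take all compositions of n and
-- remove repetitions up to permutation.

private
  1∷ : ∀ {n} → Partition n → Partition (suc n)
  1∷ (mkPartition ps pos eq) = mkPartition (1 ∷ ps) (s≤s z≤n ∷ pos) (cong suc eq)

  increaseHead : ∀ {n} → Partition n → Partition (suc n)
  increaseHead π@(mkPartition [] _ _) = 1∷ π
  increaseHead (mkPartition (p ∷ ps) (_ ∷ pos) eq) = mkPartition (suc p ∷ ps) (s≤s z≤n ∷ pos) (cong suc eq)

  compositions : ∀ n → List (Partition n)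
  compositions zero    = mkPartition [] [] refl ∷ []
  compositions (suc n) = map 1∷ (compositions n) ++ map increaseHead (compositions n)

  parts-1∷ : ∀ {n ps} (π : Partition n) → ps ≡ parts π → 1 ∷ ps ≡ parts (1∷ π)
  parts-1∷ π refl = refl

  parts-increaseHead : ∀ {n p ps} (π : Partition n) → p ∷ ps ≡ parts π →
                       suc p ∷ ps ≡ parts (increaseHead π)
  parts-increaseHead (mkPartition (_ ∷ _) (_ ∷ _) _) refl = refl

  ∈-compositions : ∀ n ps → All (_> 0) ps → sum ps ≡ n →
                   Any (λ π → ps ≡ parts π) (compositions n)
  ∈-compositions zero [] _ _ = here refl
  ∈-compositions (suc n) (suc zero ∷ ps) (_ ∷ pos) eq =
    ++⁺ˡ (map⁺ (Any.map (λ {π} → parts-1∷ π)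
      (∈-compositions n ps pos (suc-injective eq))))
  ∈-compositions (suc n) (suc (suc p) ∷ ps) (_ ∷ pos) eq =
    ++⁺ʳ (map 1∷ (compositions n)) (map⁺ (Any.map (λ {π} → parts-increaseHead π)
      (∈-compositions n (suc p ∷ ps) (s≤s z≤n ∷ pos) (suc-injective eq))))
  ∈-compositions zero (zero ∷ _) (() ∷ _)
  ∈-compositions (suc n) (zero ∷ _) (() ∷ _)

  _↭?_ : Decidable (_↭_ {A = ℕ})
  xs ↭? ys with ≡-dec _≟_ (sort ≤-decTotalOrder xs) (sort ≤-decTotalOrder ys)
  ... | yes eq = yes (↭-trans (↭-sym (sort-↭ ≤-decTotalOrder xs))
                     (↭-trans (↭-reflexive eq) (sort-↭ ≤-decTotalOrder ys)))
  ... | no neq = no λ xs↭ys → neq (Pointwise-≡⇒≡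
    (↗↭↗⇒≋ ≤-totalOrder (sort-↗ ≤-decTotalOrder xs) (sort-↗ ≤-decTotalOrder ys)
      (↭⇒↭ₛ (↭-trans (sort-↭ ≤-decTotalOrder xs)
              (↭-trans xs↭ys (↭-sym (sort-↭ ≤-decTotalOrder ys)))))))

  Partitions? : ℕ → DecSetoid 0ℓ 0ℓ
  Partitions? n = record
    { Carrier = Partition n
    ; _≈_ = Setoid._≈_ (Partitions n)
    ; isDecEquivalence = record
      { isEquivalence = Setoid.isEquivalence (Partitions n)
      ; _≟_ = λ π ρ → parts π ↭? parts ρ
      }
    }

  module _ (S : Setoid 0ℓ 0ℓ) where
    open Setoid S renaming (refl to ≈-refl; sym to ≈-sym; trans to ≈-trans)
    open UniqueSetoid S using () renaming (Unique to Uniqueₛ)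

    lookup-injective : ∀ {xs} → Uniqueₛ xs → ∀ {i j} → lookup xs i ≈ lookup xs j → i ≡ j
    lookup-injective (_ ∷ _)  {zero}  {zero}  _  = refl
    lookup-injective (x∉ ∷ _) {zero}  {suc j} eq = contradiction eq (All.lookup x∉ (∈-lookup j))
    lookup-injective (x∉ ∷ _) {suc i} {zero}  eq = contradiction (≈-sym eq) (All.lookup x∉ (∈-lookup i))
    lookup-injective (_ ∷ u)  {suc i} {suc j} eq = cong suc (lookup-injective u eq)

    enumeration⇒inverse : ∀ {xs} → IsEnumeration S xs → Uniqueₛ xs →
                          Inverse (≡.setoid (Fin (length xs))) S
    enumeration⇒inverse {xs} enum uniq = record
      { to        = lookup xs
      ; from      = index
      ; to-cong   = λ { refl → ≈-refl }
      ; from-cong = λ {x} {y} x≈y → lookup-injective uniq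
          (≈-trans (≈-sym (lookup-index (enum x))) (≈-trans x≈y (lookup-index (enum y))))
      ; inverse   = (λ { {x} refl → ≈-sym (lookup-index (enum x)) })
                  , λ {i} {x} x≈ → lookup-injective uniq
                      (≈-trans (≈-sym (lookup-index (enum x))) x≈)
      }
      where
      index : Carrier → Fin (length xs)
      index x = Any.index (enum x)

listing-exists : ∀ n → ∃ (Listing n)
listing-exists n = length πs , enumeration⇒inverse (Partitions n)
  (deduplicate⁺ (Partitions? n) λ π →
    Any.map ↭-reflexive (∈-compositions n (parts π) (positive π) (sum≡n π)))
  (UniqueDec.deduplicate-! (Partitions? n) (compositions n))
  where
  πs : List (Partition n)
  πs = deduplicate (DecSetoid._≟_ (Partitions? n)) (compositions n)

{-# OPTIONS --safe #-}
-- Partitioned orders of a fixed type (multiset of lengths) ps are counted by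
-- double counting. Cutting permutations of 0, …, n-1 into blocks of lengths ps, in
-- this order, gives n! sequences of blocks. Forgetting the order of the blocks maps
-- these onto the partitioned orders of type ps, and every fibre consists of the
-- rearrangements of the blocks that keep the sequence of lengths, so it has
-- ∏ m(j)! elements, where m(j) is the multiplicity of j in ps. Multiplied by
-- ∏ m(j)!, the product in the theorem telescopes to n! as well.
module Submission where

open import Defs
open import Algebra.Structures using (IsCommutativeMonoid)
open import Data.Fin as Fin using (Fin; zero; suc; join; splitAt)
open import Data.Fin.Permutation using (↔⇒≡)
open import Data.Fin.Properties using (join-splitAt; splitAt-join)
open import Data.List
  using (List; []; _∷_; _++_; map; length; filter; foldr; lookup; tabulate; concat;
         take; drop; allFin; applyUpTo; deduplicate)
open import Data.List.Extrema.Nat using (xs≤max)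
open import Data.List.Membership.Propositional using (_∈_)
open import Data.List.Membership.Propositional.Properties
  using (∈-lookup; ∈-∃++; ∈-filter⁺; ∈-filter⁻; ∈-allFin; ∈-concat⁺; ∈-concat⁻; ∈-concat⁺′)
open import Data.List.Membership.Propositional.Properties.WithK using (unique∧set⇒bag)
open import Data.List.Properties
  using (≡-dec; length-++; length-take; length-drop; length-tabulate; take++drop≡id;
         filter-accept; filter-reject; ∷-injectiveˡ; ∷-injectiveʳ)
open import Data.List.Relation.Binary.BagAndSetEquality
  using (_∼[_]_; set; bag-=⇒; ∼bag⇒↭; ↭⇒∼bag)
open import Data.List.Relation.Binary.Disjoint.Propositional using (Disjoint)
open import Data.List.Relation.Binary.Permutation.Propositional as Perm
  using (_↭_; prep; ↭-refl; ↭-sym; ↭-trans; ↭-reflexive; ↭⇒↭ₛ)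
open import Data.List.Relation.Binary.Permutation.Propositional.Properties
  using (↭-empty-inv; ↭-length; ↭-map-inv; ∈-resp-↭; shift; shifts; drop-∷; filter-↭; ++⁺ˡ)
  renaming (map⁺ to ↭-map⁺)
import Data.List.Relation.Binary.Permutation.Setoid.Properties as Permₛ
import Data.List.Relation.Binary.Subset.DecPropositional as DecSubset
open import Data.List.Relation.Unary.All as All using (All; []; _∷_)
import Data.List.Relation.Unary.All.Properties as All
open import Data.List.Relation.Unary.AllPairs using (AllPairs; []; _∷_)
open import Data.List.Relation.Unary.Any as Any using (here; there)
open import Data.List.Relation.Unary.Any.Properties using (lookup-index; tabulate⁺)
open import Data.List.Relation.Unary.Enumerates.Setoid using (IsEnumeration)
open import Data.List.Relation.Unary.Enumerates.Setoid.Properties using (deduplicate⁺)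
import Data.List.Relation.Unary.Unique.DecSetoid.Properties as UniqueDec
open import Data.List.Relation.Unary.Unique.Propositional using (Unique)
import Data.List.Relation.Unary.Unique.Propositional.Properties as Unique
import Data.List.Relation.Unary.Unique.Setoid as Uniqueₛ
open import Data.Nat
  using (ℕ; zero; suc; _+_; _*_; _≤_; _<_; _>_; _≥_; _∸_; _/_; _!; s≤s; z≤n; s≤s⁻¹;
         _≟_; NonZero)
open import Data.Nat.Combinatorics using (_C_; nCk≡n!/k![n-k]!; k![n∸k]!∣n!)
open import Data.Nat.Divisibility using (m≤n⇒m!∣n!)
open import Data.Nat.DivMod using (m/n*n≡m)
open import Data.Nat.ListAction using (sum)
open import Data.Nat.Properties
  using (*-1-isCommutativeMonoid; *-cancelʳ-≡; *-identityʳ; *-suc; *-zeroʳ;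
         +-0-isCommutativeMonoid; +-comm; +-identityʳ; m*n≢0⇒n≢0; m+n∸m≡n; m+n≤o⇒m≤o;
         m+n≤o⇒m≤o∸n; m≤m+n; m≤n*m; m≤n⇒m⊓n≡m; n∸n≡0; suc-injective; ∸-+-assoc;
         ≤-reflexive; ≤-trans; _!≢0; _!*_!≢0)
open import Data.Nat.Solver using (module +-*-Solver)
open import Data.Product using (Σ; ∃; _×_; _,_; proj₁; proj₂)
open import Data.Sum using (inj₁; inj₂)
open import Data.Unit using (⊤; tt)
import Data.Unit as Unit
open import Function using (Inverse; Equivalence; _∘_; id; const; mk⇔)
import Function.Construct.Composition as Comp
import Function.Construct.Symmetry as Symm
open import Level using (0ℓ)
open import Relation.Binary using (Setoid; DecSetoid; DecidableEquality; Decidable)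
import Relation.Binary.Construct.On as On
open import Relation.Binary.PropositionalEquality as ≡
  using (_≡_; _≢_; refl; sym; trans; cong; cong₂; subst; module ≡-Reasoning)
open import Relation.Nullary using (yes; no; contradiction)
open import Relation.Nullary.Decidable using (map′; _×-dec_)

open PartitionedOrder

-- Cardinalities of setoids and counting by fibres.

module _ {S T : Setoid 0ℓ 0ℓ} where
  private
    module S = Setoid S
    module T = Setoid T

  -- Congruence of both maps turns the pointwise inverse laws into the laws of `Inverse`, which
  -- speak of arguments up to equality.
  mkInverse : (to : S.Carrier → T.Carrier) (from : T.Carrier → S.Carrier) →
              (∀ {x y} → x S.≈ y → to x T.≈ to y) →
              (∀ {x y} → x T.≈ y → from x S.≈ from y) →
              (∀ y → to (from y) T.≈ y) → (∀ x → from (to x) S.≈ x) → Inverse S T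
  mkInverse to from to-cong from-cong to∘from from∘to = record
    { to        = to
    ; from      = from
    ; to-cong   = to-cong
    ; from-cong = from-cong
    ; inverse   = (λ y≈ → T.trans (to-cong y≈) (to∘from _))
                , (λ y≈ → S.trans (from-cong y≈) (from∘to _))
    }

  card-resp-≅ : ∀ {c} → Inverse S T → T HasCardinality c → S HasCardinality c
  card-resp-≅ = Comp.inverse

card-unique : ∀ S {a b} → S HasCardinality a → S HasCardinality b → a ≡ b
card-unique S a b = ↔⇒≡ (Comp.inverse (Symm.inverse a) b)

-- The intervals of sizes `f i` are laid end to end; `decode` recovers the interval and the position
-- in it.
encode : ∀ {k} (f : Fin k → ℕ) i → Fin (f i) → Fin (∑Fin k f)
encode f zero    j = join (f zero) _ (inj₁ j)
encode f (suc i) j = join (f zero) _ (inj₂ (encode (f ∘ suc) i j))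

decode : ∀ {k} (f : Fin k → ℕ) → Fin (∑Fin k f) → Σ (Fin k) (Fin ∘ f)
decode {suc k} f x with splitAt (f zero) x
... | inj₁ j = zero , j
... | inj₂ y = let i , j = decode (f ∘ suc) y in suc i , j

decode-encode : ∀ {k} (f : Fin k → ℕ) i j → decode f (encode f i j) ≡ (i , j)
decode-encode {suc k} f zero j
  rewrite splitAt-join (f zero) (∑Fin k (f ∘ suc)) (inj₁ j) = refl
decode-encode {suc k} f (suc i) j
  rewrite splitAt-join (f zero) (∑Fin k (f ∘ suc)) (inj₂ (encode (f ∘ suc) i j))
        | decode-encode (f ∘ suc) i j = refl

encode-decode : ∀ {k} (f : Fin k → ℕ) x →
                encode f (proj₁ (decode f x)) (proj₂ (decode f x)) ≡ x
encode-decode {suc k} f x with splitAt (f zero) x | join-splitAt (f zero) (∑Fin k (f ∘ suc)) x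
... | inj₁ j | eq = eq
... | inj₂ y | eq = trans (cong (join (f zero) _ ∘ inj₂) (encode-decode (f ∘ suc) y)) eq

module _ (S : Setoid 0ℓ 0ℓ) where
  open Setoid S renaming (refl to ≈-refl; sym to ≈-sym; trans to ≈-trans)

  Fibre : (Carrier → Set) → Setoid 0ℓ 0ℓ
  Fibre P = On.setoid {B = Σ Carrier P} S proj₁

  -- The map to Fin k is given by its graph R, so that the fibres over an index can be
  -- described without reference to the chosen index of an element.
  card-fibres : ∀ {k} (R : Carrier → Fin k → Set) →
                (∀ s → ∃ (R s)) →
                (∀ {s t i j} → s ≈ t → R s i → R t j → i ≡ j) →
                (f : Fin k → ℕ) →
                (∀ i → Fibre (λ s → R s i) HasCardinality f i) →
                S HasCardinality ∑Fin k f
  card-fibres {k} R class functional f card =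
    mkInverse to from to-cong (λ { refl → ≈-refl }) to∘from from∘to
    where
    module I i = Inverse (card i)

    enc : ∀ i s → R s i → Fin (∑Fin k f)
    enc i s r = encode f i (I.to i (s , r))

    -- The code depends neither on the index witnessed for an element nor on the proof of `R`:
    -- `functional` identifies the two indices, and equality in a fibre ignores the proofs.
    enc-cong : ∀ {i j s t} (r : R s i) (q : R t j) → s ≈ t → enc i s r ≡ enc j t q
    enc-cong r q s≈t with refl ← functional s≈t r q =
      cong (encode f _) (I.to-cong _ {_ , r} {_ , q} s≈t)

    to : Carrier → Fin (∑Fin k f)
    to s = enc _ s (proj₂ (class s))

    from : Fin (∑Fin k f) → Carrier
    from x = let i , j = decode f x in proj₁ (I.from i j)

    to-cong : ∀ {s t} → s ≈ t → to s ≡ to t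
    to-cong {s} {t} s≈t = enc-cong (proj₂ (class s)) (proj₂ (class t)) s≈t

    to∘from : ∀ x → to (from x) ≡ x
    to∘from x = let i , j = decode f x in begin
      to (from x)
        ≡⟨ enc-cong (proj₂ (class (from x))) (proj₂ (I.from i j)) ≈-refl ⟩
      encode f i (I.to i (I.from i j))         ≡⟨ cong (encode f i) (I.strictlyInverseˡ i j) ⟩
      encode f i j                             ≡⟨ encode-decode f x ⟩
      x                                        ∎
      where open ≡-Reasoning

    from∘to : ∀ s → from (to s) ≈ s
    from∘to s rewrite decode-encode f _ (I.to _ (s , proj₂ (class s))) =
      I.strictlyInverseʳ _ (s , proj₂ (class s))

∑Fin-const : ∀ k c → ∑Fin k (λ _ → c) ≡ k * c
∑Fin-const zero    c = refl
∑Fin-const (suc k) c = cong (c +_) (∑Fin-const k c)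

module _ (S : Setoid 0ℓ 0ℓ) where
  open Setoid S renaming (refl to ≈-refl; sym to ≈-sym; trans to ≈-trans)
  open Uniqueₛ S using () renaming (Unique to Unique-≈)

  lookup-injective : ∀ {xs} → Unique-≈ xs → ∀ {i j} → lookup xs i ≈ lookup xs j → i ≡ j
  lookup-injective (_ ∷ _)  {zero}  {zero}  _  = refl
  lookup-injective (x∉ ∷ _) {zero}  {suc j} eq = contradiction eq (All.lookup x∉ (∈-lookup j))
  lookup-injective (x∉ ∷ _) {suc i} {zero}  eq = contradiction (≈-sym eq) (All.lookup x∉ (∈-lookup i))
  lookup-injective (_ ∷ u)  {suc i} {suc j} eq = cong suc (lookup-injective u eq)

Unique-resp-↭ : ∀ {A : Set} {xs ys : List A} → xs ↭ ys → Unique xs → Unique ys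
Unique-resp-↭ p = Permₛ.Unique-resp-↭ (≡.setoid _) (↭⇒↭ₛ p)

-- Arrangements of a list with a prescribed sequence of keys.

module Multiplicity {B : Set} (_≟_ : DecidableEquality B) where

  count : B → List B → ℕ
  count k ks = length (filter (_≟ k) ks)

  -- The product of the factorials of the multiplicities, in the form that arises from
  -- choosing the entries of an arrangement one after the other.
  weight : List B → ℕ
  weight []       = 1
  weight (k ∷ ks) = count k (k ∷ ks) * weight ks

module Arrangements {A B : Set} (_≟_ : DecidableEquality B) (key : A → B) where
  open Multiplicity _≟_

  -- Only the lists are compared, because one permutation can have several proofs of `ys ↭ xs`.
  Arrangement : List A → List B → Setoid 0ℓ 0ℓ
  Arrangement xs ks = On.setoid {B = Σ (List A) λ ys → ys ↭ xs × map key ys ≡ ks}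
                                (≡.setoid (List A)) proj₁

  count-map : ∀ k xs → count k (map key xs) ≡ length (filter (λ x → key x ≟ k) xs)
  count-map k []       = refl
  count-map k (x ∷ xs) with key x ≟ k
  ... | yes _ = cong suc (count-map k xs)
  ... | no _  = count-map k xs

  -- Induction on `ks`. The head of an arrangement is one of the `count k` entries with key `k`,
  -- which are distinct because `xs` is; once it is fixed, the tail is an arrangement of the
  -- remaining entries with keys `ks`.
  card-Arrangement : ∀ {xs} ks → Unique xs → map key xs ↭ ks →
                     Arrangement xs ks HasCardinality weight ks
  card-Arrangement {[]} [] _ _ = mkInverse (λ _ → zero) (λ _ → [] , ↭-refl , refl)
    (λ _ → refl) (λ _ → refl) (λ { zero → refl }) (λ { (_ , p , _) → sym (↭-empty-inv p) })
  card-Arrangement {_ ∷ _} [] _ p = contradiction (↭-length p) λ ()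
  card-Arrangement {xs} (k ∷ ks) xs! p = subst (Arrangement xs (k ∷ ks) HasCardinality_) size
    (card-fibres (Arrangement xs (k ∷ ks)) StartsWith class
      (λ {s} {t} → functional {s} {t}) (λ _ → weight ks) card)
    where
    candidates : List A
    candidates = filter (λ x → key x ≟ k) xs

    size : ∑Fin (length candidates) (λ _ → weight ks) ≡ weight (k ∷ ks)
    size = begin
      ∑Fin (length candidates) (λ _ → weight ks) ≡⟨ ∑Fin-const (length candidates) (weight ks) ⟩
      length candidates * weight ks              ≡⟨ cong (_* weight ks) (count-map k xs) ⟨
      count k (map key xs) * weight ks           ≡⟨ cong (_* weight ks) (↭-length (filter-↭ (_≟ k) p)) ⟩
      weight (k ∷ ks)                            ∎
      where open ≡-Reasoning

    StartsWith : Setoid.Carrier (Arrangement xs (k ∷ ks)) → Fin (length candidates) → Set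
    StartsWith (ys , _) i = ∃ λ zs → ys ≡ lookup candidates i ∷ zs

    class : ∀ s → ∃ (StartsWith s)
    class (y ∷ ys , q , eq) = Any.index y∈ , ys , cong (_∷ ys) (lookup-index y∈)
      where
      y∈ : y ∈ candidates
      y∈ = ∈-filter⁺ (λ x → key x ≟ k) (∈-resp-↭ q (here refl)) (∷-injectiveˡ eq)

    functional : ∀ {s t i j} → proj₁ s ≡ proj₁ t → StartsWith s i → StartsWith t j → i ≡ j
    functional refl (_ , eq₁) (_ , eq₂) =
      lookup-injective (≡.setoid A) (Unique.filter⁺ (λ x → key x ≟ k) xs!)
        (∷-injectiveˡ (trans (sym eq₁) eq₂))

    card : ∀ i → Fibre (Arrangement xs (k ∷ ks)) (λ s → StartsWith s i) HasCardinality weight ks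
    -- Abstracting the chosen candidate to a variable `y` allows `k` to be replaced by `key y` and
    -- `xs` to be split around `y`.
    card i with lookup candidates i
              | ∈-filter⁻ (λ x → key x ≟ k) {xs = xs} (∈-lookup {xs = candidates} i)
    ... | y | y∈xs , refl with ∈-∃++ y∈xs
    ... | as , bs , refl = card-resp-≅ tail≅ (card-Arrangement ks rest! rest↭)
      where
      rest : List A
      rest = as ++ bs
      move : as ++ y ∷ bs ↭ y ∷ rest
      move = shift y as bs
      rest! : Unique rest
      rest! with _ ∷ u ← Unique-resp-↭ move xs! = u
      rest↭ : map key rest ↭ ks
      rest↭ = drop-∷ (↭-trans (↭-map⁺ key (↭-sym move)) p)
      tail≅ : Inverse (Fibre (Arrangement xs (k ∷ ks)) (λ s → ∃ λ zs → proj₁ s ≡ y ∷ zs))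
                      (Arrangement rest ks)
      tail≅ = mkInverse
        (λ { ((_ , q , eq) , zs , refl) → zs , drop-∷ (↭-trans q move) , ∷-injectiveʳ eq })
        (λ { (zs , q , eq) → (y ∷ zs , ↭-trans (prep y q) (↭-sym move) , cong (key y ∷_) eq)
                           , zs , refl })
        (λ { {_ , _ , refl} {_ , _ , refl} eq → ∷-injectiveʳ eq })
        (cong (y ∷_))
        (λ _ → refl)
        (λ { (_ , _ , refl) → refl })

-- Quotients with fibres of constant size.

module _ (S? : DecSetoid 0ℓ 0ℓ) where
  open DecSetoid S?
    renaming (setoid to S; refl to ≈-refl; sym to ≈-sym; trans to ≈-trans; _≟_ to _≈?_)

  -- The values of the surjection list every element up to equality; decidability allows the
  -- repetitions to be removed, and the length of what is left is the cardinality.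
  surjection⇒card : ∀ {a} (to : Fin a → Carrier) → (∀ s → ∃ λ i → to i ≈ s) →
                    ∃ (S HasCardinality_)
  surjection⇒card to surj = length xs ,
    mkInverse (Any.index ∘ enum) (lookup xs)
      (λ {s} {t} s≈t → injective (≈-trans (≈-sym (lookup-index (enum s)))
                                          (≈-trans s≈t (lookup-index (enum t)))))
      (λ { refl → ≈-refl })
      (λ i → injective (≈-sym (lookup-index (enum (lookup xs i)))))
      (λ s → ≈-sym (lookup-index (enum s)))
    where
    xs : List Carrier
    xs = deduplicate _≈?_ (tabulate to)
    enum : IsEnumeration S xs
    enum = deduplicate⁺ S? λ s → let i , eq = surj s in tabulate⁺ i (≈-sym eq)
    injective : ∀ {i j} → lookup xs i ≈ lookup xs j → i ≡ j
    injective = lookup-injective S (UniqueDec.deduplicate-! S? (tabulate to))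

  -- `S` is finite as an image of `T`. With `c` its cardinality, `T` splits into `c` fibres of size
  -- `b`, so `c * b` and `a` are both cardinalities of `T`.
  card-quotient : (T : Setoid 0ℓ 0ℓ) (g : Setoid.Carrier T → Carrier) →
                  (∀ {t u} → Setoid._≈_ T t u → g t ≈ g u) →
                  (∀ s → ∃ λ t → g t ≈ s) →
                  ∀ {a b} → T HasCardinality a →
                  (∀ s → Fibre T (λ t → g t ≈ s) HasCardinality b) →
                  ∃ λ c → S HasCardinality c × c * b ≡ a
  card-quotient T g g-cong surj {b = b} card-T card-fibre = c , card-S ,
    trans (sym (∑Fin-const c b)) (card-unique T
      (card-fibres T (λ t i → g t ≈ S.from i)
        (λ t → S.to (g t) , ≈-sym (S.strictlyInverseʳ (g t)))
        (λ {_} {_} {i} {j} t≈u r q → trans (sym (S.strictlyInverseˡ i))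
          (trans (S.to-cong (≈-trans (≈-sym r) (≈-trans (g-cong t≈u) q))) (S.strictlyInverseˡ j)))
        (λ _ → b) (card-fibre ∘ S.from))
      card-T)
    where
    module T = Inverse card-T
    finite : ∃ (S HasCardinality_)
    finite = surjection⇒card (g ∘ T.from) λ s → let t , eq = surj s in
      T.to t , ≈-trans (g-cong (T.strictlyInverseʳ t)) eq
    c = proj₁ finite
    card-S = proj₂ finite
    module S = Inverse card-S

-- Permutations cut into blocks of given lengths.

open Multiplicity Unit._≟_ using () renaming (weight to weight-⊤; count to count-⊤)
open Multiplicity _≟_ using (count; weight)

module _ {A : Set} where

  open Arrangements Unit._≟_ (const {A = ⊤} {B = A} tt) using ()
    renaming (Arrangement to Arrangement-⊤; card-Arrangement to card-Arrangement-⊤)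

  count-const : (xs : List A) → count-⊤ tt (map (const tt) xs) ≡ length xs
  count-const []       = refl
  count-const (x ∷ xs) = cong suc (count-const xs)

  -- Under a constant key every remaining entry is a candidate, so the numbers of choices descend
  -- from `length xs` to 1.
  weight-const : (xs : List A) → weight-⊤ (map (const tt) xs) ≡ length xs !
  weight-const []       = refl
  weight-const (x ∷ xs) = cong₂ _*_ (cong suc (count-const xs)) (weight-const xs)

  Blocks : List A → List ℕ → Setoid 0ℓ 0ℓ
  Blocks xs ps = On.setoid {B = Σ (List (List A)) λ xss → concat xss ↭ xs × map length xss ≡ ps}
                           (≡.setoid (List (List A))) proj₁

  chop : List ℕ → List A → List (List A)
  chop []       xs = []
  chop (p ∷ ps) xs = take p xs ∷ chop ps (drop p xs)

  length-concat : (xss : List (List A)) → length (concat xss) ≡ sum (map length xss)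
  length-concat []         = refl
  length-concat (xs ∷ xss) = trans (length-++ xs) (cong (length xs +_) (length-concat xss))

  length-drop-sum : ∀ p {ps} (xs : List A) → length xs ≡ p + sum ps → length (drop p xs) ≡ sum ps
  length-drop-sum p {ps} xs eq = trans (length-drop p xs) (trans (cong (_∸ p) eq) (m+n∸m≡n p (sum ps)))

  concat-chop : ∀ ps xs → length xs ≡ sum ps → concat (chop ps xs) ≡ xs
  concat-chop []       []  _ = refl
  concat-chop (p ∷ ps) xs eq = trans
    (cong (take p xs ++_) (concat-chop ps (drop p xs) (length-drop-sum p {ps} xs eq)))
    (take++drop≡id p xs)

  map-length-chop : ∀ ps xs → length xs ≡ sum ps → map length (chop ps xs) ≡ ps
  map-length-chop []       xs _  = refl
  map-length-chop (p ∷ ps) xs eq = cong₂ _∷_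
    (trans (length-take p xs) (m≤n⇒m⊓n≡m (≤-trans (m≤m+n p (sum ps)) (≤-reflexive (sym eq)))))
    (map-length-chop ps (drop p xs) (length-drop-sum p {ps} xs eq))

  take-length-++ : (xs ys : List A) → take (length xs) (xs ++ ys) ≡ xs
  take-length-++ []       ys = refl
  take-length-++ (x ∷ xs) ys = cong (x ∷_) (take-length-++ xs ys)

  drop-length-++ : (xs ys : List A) → drop (length xs) (xs ++ ys) ≡ ys
  drop-length-++ []       ys = refl
  drop-length-++ (x ∷ xs) ys = drop-length-++ xs ys

  chop-concat : ∀ xss → chop (map length xss) (concat xss) ≡ xss
  chop-concat []         = refl
  chop-concat (xs ∷ xss) = cong₂ _∷_ (take-length-++ xs (concat xss))
    (trans (cong (chop (map length xss)) (drop-length-++ xs (concat xss))) (chop-concat xss))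

  -- Each permutation of `xs` has exactly one cut into blocks of lengths `ps`, with `concat` and
  -- `chop ps` as mutually inverse maps.
  card-Blocks : ∀ {xs ps} → Unique xs → length xs ≡ sum ps → Blocks xs ps HasCardinality length xs !
  card-Blocks {xs} {ps} xs! eq = subst (Blocks xs ps HasCardinality_) (weight-const xs)
    (card-resp-≅ concat≅ (card-Arrangement-⊤ (map (const tt) xs) xs! ↭-refl))
    where
    length-≡ : ∀ {ys} → ys ↭ xs → length ys ≡ sum ps
    length-≡ p = trans (↭-length p) eq

    map-const-cong : ∀ {ys zs : List A} → length ys ≡ length zs → map (const tt) ys ≡ map (const tt) zs
    map-const-cong {[]}     {[]}     _ = refl
    map-const-cong {_ ∷ ys} {_ ∷ zs} e = cong (tt ∷_) (map-const-cong (cong (_∸ 1) e))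

    -- With a constant key, arrangements are arbitrary permutations.
    concat≅ : Inverse (Blocks xs ps) (Arrangement-⊤ xs (map (const tt) xs))
    concat≅ = mkInverse
      (λ { (xss , p , _) → concat xss , p , map-const-cong (↭-length p) })
      (λ { (ys , p , _) → chop ps ys , ↭-trans (↭-reflexive (concat-chop ps ys (length-≡ p))) p
                        , map-length-chop ps ys (length-≡ p) })
      (cong concat)
      (cong (chop ps))
      (λ { (ys , p , _) → concat-chop ps ys (length-≡ p) })
      (λ { (xss , _ , refl) → chop-concat xss })

  -- Disjointness, absence of repetitions, and set equality versus permutation.

  Disjoint⇒≢ : {xs ys : List A} → xs ≢ [] → Disjoint xs ys → xs ≢ ys
  Disjoint⇒≢ {[]}    ne _ _    = ne refl
  Disjoint⇒≢ {x ∷ _} _  # refl = # (here refl , here refl)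

  -- Non-emptiness matters: the empty list is disjoint from itself and could otherwise be repeated.
  disjoint⇒unique : {xss : List (List A)} → All (_≢ []) xss → AllPairs Disjoint xss → Unique xss
  disjoint⇒unique []         []       = []
  disjoint⇒unique (ne ∷ nes) (# ∷ #s) = All.map (Disjoint⇒≢ ne) # ∷ disjoint⇒unique nes #s

  Unique-++⁻ : ∀ xs {ys : List A} → Unique (xs ++ ys) → Unique xs × Unique ys × Disjoint xs ys
  Unique-++⁻ []       u        = [] , u , λ ()
  Unique-++⁻ (x ∷ xs) (x∉ ∷ u) with xs! , ys! , # ← Unique-++⁻ xs u =
    All.++⁻ˡ xs x∉ ∷ xs! , ys! ,
    λ { (here refl , x∈ys) → All.lookup (All.++⁻ʳ xs x∉) x∈ys refl
      ; (there v∈ , v∈ys) → # (v∈ , v∈ys) }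

  Unique-concat⁻ : ∀ xss → Unique (concat xss) → All Unique xss × AllPairs Disjoint xss
  Unique-concat⁻ []         _ = [] , []
  Unique-concat⁻ (xs ∷ xss) u with xs! , u′ , # ← Unique-++⁻ xs u
    with xss! , #s ← Unique-concat⁻ xss u′ =
    xs! ∷ xss! , All.tabulate (λ ys∈ (v∈xs , v∈ys) → # (v∈xs , ∈-concat⁺′ v∈ys ys∈)) ∷ #s

  -- Without repetitions an element is a member in at most one way, so set equality is already bag
  -- equality.
  set⇒↭ : {xs ys : List A} → Unique xs → Unique ys → xs ∼[ set ] ys → xs ↭ ys
  set⇒↭ xs! ys! eq = ∼bag⇒↭ (unique∧set⇒bag xs! ys! eq)

  ↭⇒set : {xs ys : List A} → xs ↭ ys → xs ∼[ set ] ys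
  ↭⇒set p = bag-=⇒ (↭⇒∼bag p)

concat-↭ : ∀ {A : Set} {xss yss : List (List A)} → xss ↭ yss → concat xss ↭ concat yss
concat-↭ Perm.refl           = ↭-refl
concat-↭ (Perm.prep xs p)    = ++⁺ˡ xs (concat-↭ p)
concat-↭ (Perm.swap xs ys p) = ↭-trans (shifts xs ys) (++⁺ˡ ys (++⁺ˡ xs (concat-↭ p)))
concat-↭ (Perm.trans p q)    = ↭-trans (concat-↭ p) (concat-↭ q)

-- Partitioned orders of a fixed type.

module _ {n : ℕ} where
  open Arrangements _≟_ (length {A = Fin n}) using (card-Arrangement)

  sequences-unique : (b : PartitionedOrder n) → Unique (sequences b)
  sequences-unique b = disjoint⇒unique (non-empty b) (disjoint b)

  concat-sequences : (b : PartitionedOrder n) → concat (sequences b) ↭ allFin n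
  concat-sequences b = set⇒↭ (Unique.concat⁺ (distinct b) (disjoint b)) (Unique.allFin⁺ n)
    (mk⇔ (λ _ → ∈-allFin _) (λ _ → ∈-concat⁺ (covering b _)))

  -- This makes the multiset of lengths an invariant of equality in `BP n`, so that the type of a
  -- partitioned order is well defined.
  BP⇒↭ : ∀ b c → sequences b ∼[ set ] sequences c → sequences b ↭ sequences c
  BP⇒↭ b c = set⇒↭ (sequences-unique b) (sequences-unique c)

  length-positive : ∀ {xss : List (List (Fin n))} → All (_> 0) (map length xss) → All (_≢ []) xss
  length-positive pos = All.map (λ { l refl → contradiction l λ () }) (All.map⁻ pos)

  ofBlocks : ∀ xss → concat xss ↭ allFin n → All (_> 0) (map length xss) → PartitionedOrder n
  ofBlocks xss p pos = record
    { sequences = xss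
    ; non-empty = length-positive pos
    ; distinct  = proj₁ !#
    ; disjoint  = proj₂ !#
    ; covering  = λ x → ∈-concat⁻ xss (∈-resp-↭ (↭-sym p) (∈-allFin x))
    }
    where
    !# : All Unique xss × AllPairs Disjoint xss
    !# = Unique-concat⁻ xss (Unique-resp-↭ (↭-sym p) (Unique.allFin⁺ n))

  OfType : List ℕ → Setoid 0ℓ 0ℓ
  OfType ps = Fibre (BP n) (λ b → map length (sequences b) ↭ ps)

  _∼set?_ : Decidable {A = List (List (Fin n))} (_∼[ set ]_)
  xs ∼set? ys = map′ to-set from-set (xs ⊆? ys ×-dec ys ⊆? xs)
    where
    open DecSubset (≡-dec Fin._≟_) using (_⊆_; _⊆?_)

    to-set : xs ⊆ ys × ys ⊆ xs → xs ∼[ set ] ys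
    to-set (f , g) = mk⇔ f g

    from-set : xs ∼[ set ] ys → xs ⊆ ys × ys ⊆ xs
    from-set eq = Equivalence.to eq , Equivalence.from eq

  OfType? : List ℕ → DecSetoid 0ℓ 0ℓ
  OfType? ps = record
    { Carrier = Setoid.Carrier (OfType ps)
    ; _≈_ = Setoid._≈_ (OfType ps)
    ; isDecEquivalence = record
      { isEquivalence = Setoid.isEquivalence (OfType ps)
      ; _≟_ = λ (b , _) (c , _) → sequences b ∼set? sequences c
      }
    }

  -- The double count, kept in multiplicative form: the `n !` block sequences map onto the orders of
  -- type `ps` with fibres of size `weight ps`.
  card-OfType : ∀ {ps} → All (_> 0) ps → sum ps ≡ n →
                ∃ λ c → OfType ps HasCardinality c × c * weight ps ≡ n !
  card-OfType {ps} pos sum≡ = card-quotient (OfType? ps) (Blocks (allFin n) ps) toType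
    (λ { refl {_} → ↭⇒set ↭-refl {_} }) surj
    (subst (λ l → Blocks (allFin n) ps HasCardinality l !) len
      (card-Blocks (Unique.allFin⁺ n) (trans len (sym sum≡))))
    fibre
    where
    len : length (allFin n) ≡ n
    len = length-tabulate id

    toType : Setoid.Carrier (Blocks (allFin n) ps) → Setoid.Carrier (OfType ps)
    toType (xss , p , e) = ofBlocks xss p (subst (All (_> 0)) (sym e) pos) , ↭-reflexive e

    surj : ∀ s → ∃ λ t → Setoid._≈_ (OfType ps) (toType t) s
    -- Lifting the permutation of lengths along `length` reorders the sequences of `b` until their
    -- lengths stand in the order `ps`.
    surj (b , q) with yss , refl , r ← ↭-map-inv length q =
      (yss , ↭-trans (concat-↭ (↭-sym r)) (concat-sequences b) , refl) ,
      λ {_} → ↭⇒set (↭-sym r) {_}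

    fibre : ∀ s → Fibre (Blocks (allFin n) ps) (λ t → Setoid._≈_ (OfType ps) (toType t) s)
                  HasCardinality weight ps
    -- The fibre is the setoid of arrangements of `sequences b` with key `length`. Both maps keep
    -- the list of blocks and only trade set equality for a permutation.
    fibre s@(b , q) = card-resp-≅ (mkInverse
      (λ (t@(xss , _ , e) , eq) → xss , BP⇒↭ (proj₁ (toType t)) b (λ {z} → eq {z}) , e)
      (λ (xss , p , e) → (xss , ↭-trans (concat-↭ p) (concat-sequences b) , e) ,
                       λ {_} → ↭⇒set p {_})
      id id (λ _ → refl) (λ _ → refl))
      (card-Arrangement ps (sequences-unique b) q)

-- Iterated sums and products, applied to multiplicities.

module IteratedOp {_∙_ : ℕ → ℕ → ℕ} {ε : ℕ} (M : IsCommutativeMonoid _≡_ _∙_ ε) where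
  open IsCommutativeMonoid M using (assoc; comm; identityˡ)

  -- Indices run from 0 here, so `∑₁ d f` and `∏₁ d f` are by definition the instances at `f ∘ suc`.
  ⨀ : ℕ → (ℕ → ℕ) → ℕ
  ⨀ d f = foldr _∙_ ε (applyUpTo f d)

  ⨀-cong : ∀ d {f g} → (∀ j → f j ≡ g j) → ⨀ d f ≡ ⨀ d g
  ⨀-cong zero    eq = refl
  ⨀-cong (suc d) eq = cong₂ _∙_ (eq 0) (⨀-cong d (eq ∘ suc))

  ⨀-ε : ∀ d → ⨀ d (λ _ → ε) ≡ ε
  ⨀-ε zero    = refl
  ⨀-ε (suc d) = trans (identityˡ _) (⨀-ε d)

  ⨀-snoc : ∀ d f → ⨀ (suc d) f ≡ ⨀ d f ∙ f d
  ⨀-snoc zero    f = comm (f 0) ε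
  ⨀-snoc (suc d) f = trans (cong (f 0 ∙_) (⨀-snoc d (f ∘ suc))) (sym (assoc _ _ _))

  -- Serves inductions over the parts of a partition, where adding a part alters a single
  -- multiplicity.
  ⨀-update : ∀ {d p} {f g : ℕ → ℕ} a → p < d → f p ≡ a ∙ g p → (∀ j → j ≢ p → f j ≡ g j) →
             ⨀ d f ≡ a ∙ ⨀ d g
  ⨀-update {suc d} {zero} a _ at-p off-p =
    trans (cong₂ _∙_ at-p (⨀-cong d λ j → off-p (suc j) λ ())) (assoc _ _ _)
  ⨀-update {suc d} {suc p} {f} {g} a p<d at-p off-p = begin
    f 0 ∙ ⨀ d (f ∘ suc)       ≡⟨ cong₂ _∙_ (off-p 0 λ ()) (⨀-update a (s≤s⁻¹ p<d) at-p
                                   λ j j≢p → off-p (suc j) (j≢p ∘ suc-injective)) ⟩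
    g 0 ∙ (a ∙ ⨀ d (g ∘ suc)) ≡⟨ assoc _ _ _ ⟨
    (g 0 ∙ a) ∙ ⨀ d (g ∘ suc) ≡⟨ cong (_∙ ⨀ d (g ∘ suc)) (comm (g 0) a) ⟩
    (a ∙ g 0) ∙ ⨀ d (g ∘ suc) ≡⟨ assoc _ _ _ ⟩
    a ∙ (g 0 ∙ ⨀ d (g ∘ suc)) ∎
    where open ≡-Reasoning

module Sum  = IteratedOp +-0-isCommutativeMonoid
module Prod = IteratedOp *-1-isCommutativeMonoid

count-≡ : ∀ p ps → count p (p ∷ ps) ≡ suc (count p ps)
count-≡ p ps = cong length (filter-accept (_≟ p) {xs = ps} refl)

count-≢ : ∀ {j p} ps → j ≢ p → count j (p ∷ ps) ≡ count j ps
count-≢ {j} ps j≢p = cong length (filter-reject (_≟ j) {xs = ps} (j≢p ∘ sym))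

-- Adding a part `p` multiplies the factor at `p` by the new multiplicity of `p`, which is also the
-- factor that `weight` gains. The bounds place `p` between 1 and `d`.
weight≡∏! : ∀ {d ps} → All (_> 0) ps → All (_≤ d) ps → weight ps ≡ ∏₁ d (λ j → count j ps !)
weight≡∏! {d} [] [] = sym (Prod.⨀-ε d)
weight≡∏! {d} {suc q ∷ ps} (_ ∷ pos) (p≤d ∷ ≤d) = begin
  count (suc q) (suc q ∷ ps) * weight ps
    ≡⟨ cong (count (suc q) (suc q ∷ ps) *_) (weight≡∏! pos ≤d) ⟩
  count (suc q) (suc q ∷ ps) * ∏₁ d (λ j → count j ps !)
    ≡⟨ Prod.⨀-update (count (suc q) (suc q ∷ ps)) p≤d at-q
         (λ j j≢q → cong _! (count-≢ ps (j≢q ∘ suc-injective))) ⟨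
  ∏₁ d (λ j → count j (suc q ∷ ps) !) ∎
  where
  open ≡-Reasoning
  at-q : count (suc q) (suc q ∷ ps) ! ≡ count (suc q) (suc q ∷ ps) * count (suc q) ps !
  at-q rewrite count-≡ (suc q) ps = refl

-- Adding a part `p` raises the summand at `p` by `p` and leaves the others alone.
∑-count : ∀ {d ps} → All (_> 0) ps → All (_≤ d) ps → ∑₁ d (λ j → j * count j ps) ≡ sum ps
∑-count {d} [] [] = trans (Sum.⨀-cong d (λ j → *-zeroʳ (suc j))) (Sum.⨀-ε d)
∑-count {d} {suc q ∷ ps} (_ ∷ pos) (p≤d ∷ ≤d) = begin
  ∑₁ d (λ j → j * count j (suc q ∷ ps))
    ≡⟨ Sum.⨀-update (suc q) p≤d at-q
         (λ j j≢q → cong (suc j *_) (count-≢ ps (j≢q ∘ suc-injective))) ⟩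
  suc q + ∑₁ d (λ j → j * count j ps)
    ≡⟨ cong (suc q +_) (∑-count pos ≤d) ⟩
  suc q + sum ps ∎
  where
  open ≡-Reasoning
  at-q : suc q * count (suc q) (suc q ∷ ps) ≡ suc q + suc q * count (suc q) ps
  at-q = trans (cong (suc q *_) (count-≡ (suc q) ps)) (*-suc (suc q) (count (suc q) ps))

-- Telescoping of the product formula.

nCk*k!*[n∸k]!≡n! : ∀ {n k} → k ≤ n → (n C k) * (k ! * (n ∸ k) !) ≡ n !
nCk*k!*[n∸k]!≡n! {n} {k} k≤n = trans (cong (_* (k ! * (n ∸ k) !)) (nCk≡n!/k![n-k]! k≤n))
  (m/n*n≡m {{k !* (n ∸ k) !≢0}} (k![n∸k]!∣n! k≤n))

regroup : ∀ P c q Q b r → P * (c * q) * (Q * b) * r ≡ P * Q * (c * (q * b * r))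
regroup = solve 6 (λ P c q Q b r →
  P :* (c :* q) :* (Q :* b) :* r := P :* Q :* (c :* (q :* b :* r))) refl
  where open +-*-Solver

module Telescope (n : ℕ) (m : ℕ → ℕ) where

  S : ℕ → ℕ
  S d = ∑₁ d (λ k → k * m k)

  term : ℕ → ℕ
  term j = ((n ∸ S (j ∸ 1)) C (j * m j)) * (_/_ ((j * m j) !) (m j !) {{m j !≢0}})

  -- Induction on `d`: the last factors, with `N = n ∸ S d` and `a = suc d * m (suc d)`, combine
  -- with `(N ∸ a) !` to `N !`, the remainder for `d`. The bound `S d ≤ n` keeps the subtraction
  -- from being truncated.
  telescope : ∀ d → S d ≤ n → ∏₁ d term * ∏₁ d (λ j → m j !) * (n ∸ S d) ! ≡ n !
  telescope zero    _   = +-identityʳ (n !)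
  telescope (suc d) S≤n = begin
    ∏₁ (suc d) term * ∏₁ (suc d) (λ j → m j !) * (n ∸ S (suc d)) !
      ≡⟨ cong₂ _*_ (cong₂ _*_ (Prod.⨀-snoc d (term ∘ suc)) (Prod.⨀-snoc d (λ j → m (suc j) !)))
                   (cong (λ s → (n ∸ s) !) S-suc) ⟩
    P * (c * q) * (Q * b !) * (n ∸ (S d + a)) !
      ≡⟨ cong (λ r → P * (c * q) * (Q * b !) * r !) (∸-+-assoc n (S d) a) ⟨
    P * (c * q) * (Q * b !) * (N ∸ a) !
      ≡⟨ regroup P c q Q (b !) ((N ∸ a) !) ⟩
    P * Q * (c * (q * b ! * (N ∸ a) !))
      -- The division in `q` is exact: `b ≤ a`, hence `b !` divides `a !`.
      ≡⟨ cong (λ x → P * Q * (c * (x * (N ∸ a) !)))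
              (m/n*n≡m {{b !≢0}} (m≤n⇒m!∣n! (m≤n*m b (suc d)))) ⟩
    P * Q * (c * (a ! * (N ∸ a) !))
      ≡⟨ cong (P * Q *_) (nCk*k!*[n∸k]!≡n! a≤N) ⟩
    P * Q * N !
      ≡⟨ telescope d (m+n≤o⇒m≤o (S d) Sd+a≤n) ⟩
    n ! ∎
    where
    open ≡-Reasoning
    P = ∏₁ d term
    Q = ∏₁ d (λ j → m j !)
    N = n ∸ S d
    b = m (suc d)
    a = suc d * b
    c = N C a
    q = _/_ (a !) (b !) {{b !≢0}}
    S-suc : S (suc d) ≡ S d + a
    S-suc = Sum.⨀-snoc d (λ k → suc k * m (suc k))
    Sd+a≤n : S d + a ≤ n
    Sd+a≤n = ≤-trans (≤-reflexive (sym S-suc)) S≤n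
    a≤N : a ≤ N
    a≤N = m+n≤o⇒m≤o∸n a (≤-trans (≤-reflexive (+-comm a (S d))) Sd+a≤n)

-- The count for one partition, and the sum over all types.

module _ {n : ℕ} (π : Partition n) where
  open Partition π

  -- The cardinality and the product both give `n !` when multiplied by `weight parts`, which is
  -- nonzero since `n !` is, and so can be cancelled.
  card-OfType-formula : OfType {n} parts HasCardinality
                        ∏₁ (maxPart π) (Telescope.term n (multiplicity π))
  card-OfType-formula = subst (OfType parts HasCardinality_)
    (*-cancelʳ-≡ c F (weight parts) {{w≢0}} (trans c*w≡n! (sym F*w≡n!))) card-c
    where
    open Telescope n (multiplicity π)
    counted : ∃ λ c → OfType parts HasCardinality c × c * weight parts ≡ n !
    counted = card-OfType positive sum≡n
    c = proj₁ counted
    card-c = proj₁ (proj₂ counted)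
    c*w≡n! = proj₂ (proj₂ counted)
    d F Q : ℕ
    d = maxPart π
    F = ∏₁ d term
    Q = ∏₁ d (λ j → multiplicity π j !)
    S≡n : S d ≡ n
    S≡n = trans (∑-count positive (xs≤max 0 parts)) sum≡n
    F*w≡n! : F * weight parts ≡ n !
    F*w≡n! = begin
      F * weight parts     ≡⟨ cong (F *_) (weight≡∏! positive (xs≤max 0 parts)) ⟩
      F * Q                ≡⟨ *-identityʳ (F * Q) ⟨
      -- All parts are at most `d`, so `S d` is `n` and the remaining factorial is `0 !`.
      F * Q * 0 !          ≡⟨ cong (λ r → F * Q * r !) (trans (cong (n ∸_) S≡n) (n∸n≡0 n)) ⟨
      F * Q * (n ∸ S d) !  ≡⟨ telescope d (≤-reflexive S≡n) ⟩
      n !                  ∎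
      where open ≡-Reasoning
    w≢0 : NonZero (weight parts)
    w≢0 = m*n≢0⇒n≢0 F {{subst NonZero (sym F*w≡n!) (n !≢0)}}

lengths : ∀ {n} → PartitionedOrder n → Partition n
lengths {n} b = mkPartition (map length (sequences b))
  (All.map⁺ (All.map (λ { {[]} ne → contradiction refl ne ; {_ ∷ _} _ → s≤s z≤n }) (non-empty b)))
  (trans (sym (length-concat (sequences b)))
    (trans (↭-length (concat-sequences b)) (length-tabulate {n = n} id)))

proposition2 : ∀ n → n ≥ 1 → ∀ p (listing : Listing n p) →
    BP n HasCardinality
      ∑Fin p (λ i →
        let d = maxPart (Inverse.to listing i)
            m = multiplicity (Inverse.to listing i)
        in ∏₁ d (λ j →
             ((n ∸ ∑₁ (j ∸ 1) (λ k → k * m k)) C (j * m j))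
               * (_/_ ((j * m j) !) (m j !) {{m j !≢0}})))
-- The orders are grouped by the index of their type in `listing`. Equal orders have the same
-- lengths up to permutation, and the listing names each partition once, so the index is unique.
proposition2 n _ p listing = card-fibres (BP n) HasType
  (λ b → L.from (lengths b) , ↭-sym (L.strictlyInverseˡ (lengths b)))
  (λ {b} {c} {i} {j} b≈c r q → trans (sym (L.strictlyInverseʳ i)) (L.inverseʳ
    (↭-trans (↭-sym r) (↭-trans (↭-map⁺ length (BP⇒↭ b c (λ {z} → b≈c {z}))) q))))
  _ (λ i → card-OfType-formula (L.to i))
  where
  module L = Inverse listing
  HasType : PartitionedOrder n → Fin p → Set
  HasType b i = map length (sequences b) ↭ Partition.parts (L.to i)
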